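{- For integers $n,d\ge 1$, the set of clauses $d\text{ - }\mathrm{RLNP}_n$ has a $\mathrm{Res}(d+1)$ refutation of size $O(dn^3)$; that is, there is an absolute constant $C$ such that for all $n,d\ge 1$ there is a $\mathrm{Res}(d+1)$ refutation of $d\text{ - }\mathrm{RLNP}_n$ of size at most $C\,d\,n^3$.
   Context: Notation: $[n]=\{1,\dots,n\}$. A literal is a propositional variable or its negation. An $e$-conjunction is a conjunction of at most $e$ literals; an $e$-DNF is a disjunction of arbitrarily many $e$-conjunctions. A clause is a disjunction of literals (so it is an $e$-DNF for every $e\ge 1$). The system $\mathrm{Res}(e)$ ($e\ge1$). Lines are $e$-DNFs. Rules ($\mathcal P,\mathcal Q$ are $e$-DNFs, the $\ell_i$ are literals, and all conjunctions have at most $e$ literals): ($\wedge$-introduction) from $\mathcal P\vee\bigwedge_{i\in I_1}\ell_i$ and $\mathcal Q\vee\bigwedge_{i\in I_2}\ell_i$ derive $\mathcal P\vee\mathcal Q\vee\bigwedge_{i\in I_1\cup I_2}\ell_i$, provided $|I_1\cup I_2|\le e$; (cut) from $\mathcal P\vee\bigvee_{i\in I}\ell_i$ and $\mathcal Q\vee\bigwedge_{i\in I}\neg\ell_i$ derive $\mathcal P\vee\mathcal Q$; (weakening 1) from $\mathcal P$ derive $\mathcal P\vee\bigwedge_{i\in I}\ell_i$, provided $|I|\le e$; (weakening 2) from $\mathcal P\vee\bigwedge_{i\in I_1\cup I_2}\ell_i$ derive $\mathcal P\vee\bigwedge_{i\in I_1}\ell_i$. A $\mathrm{Res}(e)$ refutation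 of a set of clauses is a derivation of the empty clause from these clauses (axioms), viewed as a directed acyclic graph whose sources are axioms and whose only sink is the empty clause. Its size is the number of internal nodes, i.e. the number of rule applications. The contradiction $d\text{ - }\mathrm{RLNP}_n$ ($d$-relativized Least number principle). Variables: $L_{i,j}$, $S_{i,j}$ for $i,j\in[n]$, and $R^p_i$ for $i\in[n]$, $p\in[d]$. Write $\mathcal R_i$ for $\bigwedge_{p\in[d]}R^p_i$, so that $\neg\mathcal R_i$ abbreviates $\bigvee_{p\in[d]}\neg R^p_i$. The clauses are: $\neg\mathcal R_i\vee\neg L_{i,i}$ for $i\in[n]$; $\neg\mathcal R_i\vee\neg\mathcal R_j\vee\neg\mathcal R_\ell\vee\neg L_{i,j}\vee\neg L_{j,\ell}\vee L_{i,\ell}$ for $i,j,\ell\in[n]$; $\bigvee_{i\in[n]}S_{i,j}$ for $j\in[n]$; $\neg S_{i,j}\vee\neg\mathcal R_j\vee R^p_i$ for $i,j\in[n]$, $p\in[d]$; $\neg S_{i,j}\vee\neg\mathcal R_j\vee L_{i,j}$ for $i,j\in[n]$; $R^p_n$ for $p\in[d]$. -}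

module Defs where

open import Data.Fin using (Fin; zero; suc; toℕ)
open import Data.List using (List; []; _∷_; [_]; _++_; map; length; lookup; allFin)
open import Data.List.Membership.Propositional using (_∈_)
open import Data.List.Relation.Binary.BagAndSetEquality using ([_]-Equality; set)
open import Data.List.Relation.Binary.Subset.Setoid using (_⊆_)
open import Data.List.Relation.Unary.All using (All)
open import Data.Empty using (⊥)
open import Data.Nat using (ℕ; zero; suc; _≤_)
open import Data.Product using (_×_)
open import Data.Sum using (_⊎_)
open import Relation.Binary.PropositionalEquality using (_≡_)

data Literal (V : Set) : Set where
  pos neg : V → Literal V

∼_ : ∀ {V} → Literal V → Literal V
∼ pos x = neg x
∼ neg x = pos x

Clause : Set → Set
Clause V = List (Literal V)

Conjunction : Set → Set
Conjunction V = List (Literal V)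

DNF : Set → Set
DNF V = List (Conjunction V)

IsDNF : ∀ {V} → ℕ → DNF V → Set
IsDNF e P = All (λ C → length C ≤ e) P

asDNF : ∀ {V} → Clause V → DNF V
asDNF c = map [_] c

-- Conjunctions are lists standing for sets of literals, and DNFs are lists
-- standing for sets of such sets: order and repetition are immaterial at both
-- levels.
infix 4 _≋_

_≋_ : ∀ {V} → DNF V → DNF V → Set
_≋_ {V} P Q = (P ⊑ Q) × (Q ⊑ P)
  where
  _⊑_ : DNF V → DNF V → Set
  _⊑_ = _⊆_ ([ set ]-Equality (Literal V))

-- `Rule Xs Z`: Z follows from the list of premises Xs in one step of Res(e).
-- The bound e does not occur here: `Derivation` requires every line to be an
-- e-DNF, which yields the provisos |I₁ ∪ I₂| ≤ e and |I| ≤ e.  A conclusion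
-- need only be ≋ to the displayed formula, so it can list each of its
-- conjunctions without repetitions.
data Rule {V : Set} : List (DNF V) → DNF V → Set where
  ∧-intro : ∀ {X Y Z} P Q C₁ C₂ →
            X ≋ C₁ ∷ P → Y ≋ C₂ ∷ Q → Z ≋ (C₁ ++ C₂) ∷ (P ++ Q) →
            Rule (X ∷ Y ∷ []) Z
  cut     : ∀ {X Y Z} P Q (ls : List (Literal V)) →
            X ≋ asDNF ls ++ P → Y ≋ map ∼_ ls ∷ Q → Z ≋ P ++ Q →
            Rule (X ∷ Y ∷ []) Z
  weaken₁ : ∀ {X Z} P C →
            X ≋ P → Z ≋ C ∷ P →
            Rule (X ∷ []) Z
  weaken₂ : ∀ {X Z} P C₁ C₂ →
            X ≋ (C₁ ++ C₂) ∷ P → Z ≋ C₁ ∷ P →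
            Rule (X ∷ []) Z

-- The nodes of the dag in a topological order, latest first; premises are
-- given as positions among the earlier nodes, so nodes can be shared and two
-- nodes may carry the same line.
data Derivation {V : Set} (e : ℕ) (Γ : Clause V → Set) : List (DNF V) → Set where
  []    : Derivation e Γ []
  axiom : ∀ {Xs} → Derivation e Γ Xs →
          ∀ c → Γ c → IsDNF e (asDNF c) → Derivation e Γ (asDNF c ∷ Xs)
  rule  : ∀ {Xs} → Derivation e Γ Xs →
          ∀ Z → IsDNF e Z →
          (is : List (Fin (length Xs))) → Rule (map (lookup Xs) is) Z →
          Derivation e Γ (Z ∷ Xs)

#rules : ∀ {V e Γ} {Xs : List (DNF V)} → Derivation e Γ Xs → ℕ
#rules []             = 0
#rules (axiom π _ _ _)  = #rules π
#rules (rule π _ _ _ _) = suc (#rules π)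

-- Node i is a premise of some later node, i.e. it is not a sink.
Used : ∀ {V e Γ} {Xs : List (DNF V)} → Derivation e Γ Xs → Fin (length Xs) → Set
Used (axiom π _ _ _)   zero    = ⊥
Used (axiom π _ _ _)   (suc i) = Used π i
Used (rule π _ _ _ _)  zero    = ⊥
Used (rule π _ _ is _) (suc i) = (i ∈ is) ⊎ Used π i

record Refutation {V : Set} (e : ℕ) (Γ : Clause V → Set) : Set where
  field
    {earlier}  : List (DNF V)
    derivation : Derivation e Γ (asDNF [] ∷ earlier)
    onlySink   : ∀ i → Used derivation (suc i)

  size : ℕ
  size = #rules derivation

open Refutation public using (size)

data Var (d n : ℕ) : Set where
  L S : Fin n → Fin n → Var d n
  R   : Fin d → Fin n → Var d n

¬ℛ : ∀ {d n} → Fin n → Clause (Var d n)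
¬ℛ {d} i = map (λ p → neg (R p i)) (allFin d)

data RLNP (d n : ℕ) : Clause (Var d n) → Set where
  irreflexive : ∀ i →
    RLNP d n (¬ℛ i ++ neg (L i i) ∷ [])
  transitive  : ∀ i j l →
    RLNP d n (¬ℛ i ++ ¬ℛ j ++ ¬ℛ l ++ neg (L i j) ∷ neg (L j l) ∷ pos (L i l) ∷ [])
  successor   : ∀ j →
    RLNP d n (map (λ i → pos (S i j)) (allFin n))
  S⇒R         : ∀ i j p →
    RLNP d n (neg (S i j) ∷ ¬ℛ j ++ pos (R p i) ∷ [])
  S⇒L         : ∀ i j →
    RLNP d n (neg (S i j) ∷ ¬ℛ j ++ pos (L i j) ∷ [])
  -- Fin n counts from 0, so the element n of [n] is the i with 1 + toℕ i ≡ n.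
  last        : ∀ i p → suc (toℕ i) ≡ n →
    RLNP d n (pos (R p i) ∷ [])

{-# OPTIONS --safe #-}

-- For a list `is` of elements, let D is j be the line ¬ℛ_j ∨ ⋁_{i ∈ is} (ℛ_i ∧ L_{i,j}): if j is
-- relevant, some relevant element of `is` lies below it.  The S-clauses give D [n] j for every j,
-- and elements are then removed from the list one at a time.  To remove k, write G for the line
-- D is k, which is D (k ∷ is) k cut with irreflexivity.  Cutting ℛ_k, which is obtained from
-- D (k ∷ is) j by weakening, with G turns "k is below j" into "some i in `is` is below k",
-- and then each disjunct ℛ_i ∧ L_{i,k} is turned into ℛ_i ∧ L_{i,j} by transitivity: L_{i,j} comes
-- from cuts and ℛ_i from weakening the disjunct itself, so one ∧-introduction rejoins them.  This
-- is O(1) rules for each triple (k, j, i).  In the end D [] n = ¬ℛ_n contradicts ℛ_n.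
module Submission where

open import Defs
open import Algebra.Bundles using (IdempotentCommutativeMonoid)
open import Algebra.Structures using (IsIdempotentCommutativeMonoid)
open import Algebra.Structures.Biased using (isCommutativeMonoidˡ)
import Algebra.Solver.IdempotentCommutativeMonoid as ICMSolver
open import Data.Empty using (⊥; ⊥-elim)
open import Data.Fin using (Fin; zero; suc; toℕ; fromℕ)
import Data.Fin.Properties as Fin
open import Data.List using (List; []; _∷_; [_]; _++_; map; length; lookup; allFin)
open import Data.List.Membership.DecPropositional using (_∈?_)
open import Data.List.Membership.Propositional using (_∈_; mapWith∈; find; lose)
open import Data.List.Membership.Propositional.Properties
  using (map-mapWith∈; mapWith∈-cong; mapWith∈≗map; ∈-++⁻; ∈-++⁺ʳ; ∈-++⁺ˡ; ∈-map⁺; ∈-allFin)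
open import Data.List.Properties
  using (map-++; map-∘; length-++; length-map; length-tabulate; ++-assoc; ++-identityʳ)
open import Data.List.Relation.Binary.BagAndSetEquality using (set; [_]-Equality)
import Data.List.Relation.Binary.Subset.Setoid as Subset
open import Data.List.Relation.Binary.Subset.Propositional using (_⊆_)
open import Data.List.Relation.Binary.Subset.Propositional.Properties
  using (⊆-refl; ⊆-trans; ++⁺; xs⊆ys++xs; All-resp-⊇; Any-resp-⊆)
open import Data.List.Relation.Unary.All as All using (All; []; _∷_)
import Data.List.Relation.Unary.All.Properties as All
open import Data.List.Relation.Unary.Any as Any using (Any; here; there; index)
open import Data.List.Relation.Unary.Any.Properties using (lookup-index)
open import Data.Nat using (ℕ; suc; _≤_; _+_; _*_; _^_; s≤s; z≤n)
open import Data.Nat.Properties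
  using (≤-refl; ≤-reflexive; ≤-trans; m≤n⇒m≤1+n; n≤1+n; m≤m+n; +-assoc; +-comm; +-identityʳ;
         *-identityʳ; +-monoˡ-≤; +-monoʳ-≤; *-monoˡ-≤)
open import Data.Nat.Solver using (module +-*-Solver)
open import Data.Product using (∃-syntax; Σ-syntax; _×_; _,_)
open import Data.Sum using (_⊎_; inj₁; inj₂; map₂; [_,_]′)
open import Data.Unit using (⊤)
open import Function using (_∘_; id)
open import Level using (0ℓ)
open import Relation.Binary.PropositionalEquality
  using (_≡_; refl; sym; trans; cong; cong₂; subst)
open import Relation.Nullary using (¬_; yes; no)
open import Relation.Nullary.Decidable using (_⊎-dec_)
open import Relation.Unary using (Pred; Decidable)

-- Trimming a derivation to the ancestors of chosen nodes.

module _ {V : Set} {e : ℕ} {Γ : Clause V → Set} where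

  -- The part of π from which the nodes in N descend; every node of it is used, except possibly
  -- the images of those in N.
  record Trimmed {Xs} (π : Derivation e Γ Xs) (N : Pred (Fin (length Xs)) 0ℓ) : Set where
    field
      {lines}  : List (DNF V)
      trimmed  : Derivation e Γ lines
      cost     : #rules trimmed ≤ #rules π
      image    : ∀ {i} → N i → Fin (length lines)
      image-≡  : ∀ {i} (n : N i) → lookup lines (image n) ≡ lookup Xs i
      sinks    : ∀ j → Used trimmed j ⊎ (∃[ i ] Σ[ n ∈ N i ] image n ≡ j)

  open Trimmed

  skip : ∀ {X Xs} {π : Derivation e Γ Xs} (ρ : Derivation e Γ (X ∷ Xs)) →
         #rules π ≤ #rules ρ → {N : Pred (Fin (length (X ∷ Xs))) 0ℓ} →
         ¬ N zero → Trimmed π (N ∘ suc) → Trimmed ρ N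
  skip ρ π≤ρ {N} ¬N0 t = record
    { trimmed = trimmed t
    ; cost    = ≤-trans (cost t) π≤ρ
    ; image   = λ { {zero} n → ⊥-elim (¬N0 n) ; {suc i} n → image t n }
    ; image-≡ = λ { {zero} n → ⊥-elim (¬N0 n) ; {suc i} n → image-≡ t n }
    ; sinks   = λ j → map₂ (λ { (i , n , eq) → suc i , n , eq }) (sinks t j)
    }

  mapWith∈-covers : ∀ {A B : Set} (xs : List A) (f : ∀ {x} → x ∈ xs → B) {x} (x∈xs : x ∈ xs) →
                    f x∈xs ∈ mapWith∈ xs f
  mapWith∈-covers (x ∷ xs) f (here refl)  = here refl
  mapWith∈-covers (x ∷ xs) f (there x∈xs) = there (mapWith∈-covers xs (f ∘ there) x∈xs)

  -- One pass from the latest node to the earliest. A node outside `N` is dropped; a kept rule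
  -- application puts its premises into the set required of the earlier nodes. So a node survives
  -- only if it is in `N` or a surviving node needs it.
  trim : ∀ {Xs} (π : Derivation e Γ Xs) {N : Pred (Fin (length Xs)) 0ℓ} → Decidable N → Trimmed π N
  trim [] N? = record
    { trimmed = [] ; cost = ≤-refl ; image = λ { {()} } ; image-≡ = λ { {()} } ; sinks = λ () }
  trim (axiom π c c∈Γ b) {N} N? with N? zero
  ... | no ¬N0 = skip (axiom π c c∈Γ b) ≤-refl ¬N0 (trim π (N? ∘ suc))
  ... | yes N0 = record
    { trimmed = axiom (trimmed t) c c∈Γ b
    ; cost    = cost t
    ; image   = λ { {zero} n → zero ; {suc i} n → suc (image t n) }
    ; image-≡ = λ { {zero} n → refl ; {suc i} n → image-≡ t n }
    ; sinks   = λ { zero → inj₂ (zero , N0 , refl)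
                  ; (suc j) → map₂ (λ { (i , n , eq) → suc i , n , cong suc eq }) (sinks t j) }
    }
    where
    t : Trimmed π (N ∘ suc)
    t = trim π (N? ∘ suc)
  trim {Z ∷ Xs} (rule π Z b is r) {N} N? with N? zero
  ... | no ¬N0 = skip (rule π Z b is r) (m≤n⇒m≤1+n ≤-refl) ¬N0 (trim π (N? ∘ suc))
  ... | yes N0 = record
    { trimmed = rule (trimmed t) Z b is′ (subst (λ Ys → Rule Ys Z) (sym premises) r)
    ; cost    = s≤s (cost t)
    ; image   = λ { {zero} n → zero ; {suc i} n → suc (image t (inj₂ n)) }
    ; image-≡ = λ { {zero} n → refl ; {suc i} n → image-≡ t (inj₂ n) }
    ; sinks   = λ { zero → inj₂ (zero , N0 , refl) ; (suc j) → sinks′ j (sinks t j) }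
    }
    where
    t : Trimmed π (λ i → i ∈ is ⊎ N (suc i))
    t = trim π (λ i → _∈?_ Fin._≟_ i is ⊎-dec N? (suc i))

    is′ : List (Fin (length (lines t)))
    is′ = mapWith∈ is (image t ∘ inj₁)

    premises : map (lookup (lines t)) is′ ≡ map (lookup Xs) is
    premises = trans (map-mapWith∈ is _ _)
      (trans (mapWith∈-cong is _ _ (image-≡ t ∘ inj₁)) (mapWith∈≗map (lookup Xs) is))

    sinks′ : ∀ j → Used (trimmed t) j ⊎ (∃[ i ] Σ[ n ∈ _ ] image t {i} n ≡ j) →
             (j ∈ is′ ⊎ Used (trimmed t) j) ⊎ (∃[ i ] Σ[ n ∈ N i ] _ ≡ suc j)
    sinks′ j (inj₁ used)                = inj₁ (inj₂ used)
    sinks′ j (inj₂ (i , inj₁ i∈is , refl)) = inj₁ (inj₁ (mapWith∈-covers is _ i∈is))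
    sinks′ j (inj₂ (i , inj₂ n , eq))   = inj₂ (suc i , n , cong suc eq)

  head-unused : ∀ {X Xs} (π : Derivation e Γ (X ∷ Xs)) → Used π zero → ⊥
  head-unused (axiom _ _ _ _)  ()
  head-unused (rule _ _ _ _ _) ()

  -- The latest node is never a premise, so the unique possible sink `i` must be that node, which is
  -- where `Refutation` wants the empty clause.
  fromSink : ∀ {Xs} (π : Derivation e Γ Xs) (i : Fin (length Xs)) → lookup Xs i ≡ [] →
             (∀ j → Used π j ⊎ i ≡ j) → Σ[ ρ ∈ Refutation e Γ ] size ρ ≡ #rules π
  fromSink {X ∷ Xs} π i i-empty only with only zero
  ... | inj₁ used = ⊥-elim (head-unused π used)
  fromSink {[] ∷ Xs} π zero refl only | inj₂ refl =
    record { derivation = π ; onlySink = λ j → used j (only (suc j)) } , refl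
    where
    used : ∀ j → Used π (suc j) ⊎ zero ≡ suc j → Used π (suc j)
    used j (inj₁ u) = u

  refutation : ∀ {Xs} (π : Derivation e Γ Xs) → [] ∈ Xs →
               Σ[ ρ ∈ Refutation e Γ ] size ρ ≤ #rules π
  refutation π []∈Xs =
    let t = trim π (Fin._≟ index []∈Xs)
        ρ , size≡ = fromSink (trimmed t) (image t refl)
                      (trans (image-≡ t refl) (sym (lookup-index []∈Xs)))
                      (λ j → map₂ (λ { (_ , refl , eq) → eq }) (sinks t j))
    in ρ , ≤-trans (≤-reflexive size≡) (cost t)

length-allFin : ∀ n → length (allFin n) ≡ n
length-allFin n = length-tabulate id

-- Lists up to order and repetition.

infix 4 _≈_

-- On DNFs this is finer than `≋`: the conjunctions themselves are compared as lists, so length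
-- bounds transfer along it. Under `++` it gives an idempotent commutative monoid, so a solver can
-- rearrange side formulas.
record _≈_ {A : Set} (xs ys : List A) : Set where
  constructor _,_
  field
    to   : xs ⊆ ys
    from : ys ⊆ xs

open _≈_

module _ {A : Set} where

  ≈-refl : {xs : List A} → xs ≈ xs
  ≈-refl = ⊆-refl , ⊆-refl

  ≈-trans : {xs ys zs : List A} → xs ≈ ys → ys ≈ zs → xs ≈ zs
  ≈-trans p q = ⊆-trans (to p) (to q) , ⊆-trans (from q) (from p)

  ≈-reflexive : {xs ys : List A} → xs ≡ ys → xs ≈ ys
  ≈-reflexive refl = ≈-refl

  absorb : ∀ {xs ys : List A} → xs ⊆ ys → xs ++ ys ≈ ys
  absorb {xs} {ys} sub = ([ sub , id ]′ ∘ ∈-++⁻ xs) , ∈-++⁺ʳ xs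

  ++-isIdempotentCommutativeMonoid : IsIdempotentCommutativeMonoid (_≈_ {A}) _++_ []
  ++-isIdempotentCommutativeMonoid = record
    { isCommutativeMonoid = isCommutativeMonoidˡ record
      { isSemigroup = record
        { isMagma = record
          { isEquivalence = record
            { refl = ≈-refl ; sym = λ p → from p , to p ; trans = ≈-trans }
          ; ∙-cong = λ p q → ++⁺ (to p) (to q) , ++⁺ (from p) (from q) }
        ; assoc = λ xs ys zs → ≈-reflexive (++-assoc xs ys zs) }
      ; identityˡ = λ _ → ≈-refl
      ; comm = λ xs ys → swap xs ys , swap ys xs }
    ; idem = λ _ → absorb ⊆-refl }
    where
    swap : ∀ (xs ys : List A) → xs ++ ys ⊆ ys ++ xs
    swap xs ys = [ ∈-++⁺ʳ ys , ∈-++⁺ˡ ]′ ∘ ∈-++⁻ xs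

++-idempotentCommutativeMonoid : Set → IdempotentCommutativeMonoid 0ℓ 0ℓ
++-idempotentCommutativeMonoid A = record
  { isIdempotentCommutativeMonoid = ++-isIdempotentCommutativeMonoid {A} }

≈⇒≋ : ∀ {V} {X Y : DNF V} → X ≈ Y → X ≋ Y
≈⇒≋ X≈Y = via (to X≈Y) , via (from X≈Y)
  where
  via : ∀ {P Q} → P ⊆ Q → Subset._⊆_ ([ set ]-Equality _) P Q
  via sub x∈P with find x∈P
  ... | z , z∈P , x∼z = lose (sub z∈P) x∼z

-- A calculus of derivations that counts rule applications.

module Calculus {V : Set} (e′ : ℕ) (Γ : Clause V → Set) where

  private e = suc e′

  infix 4 _⊩_

  _⊩_ : List (DNF V) → List (DNF V) → Set
  Xs ⊩ Zs = All (λ Z → Any (_≈ Z) Xs) Zs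

  record Extension {Xs} (π : Derivation e Γ Xs) (m : ℕ) (Zs : List (DNF V)) : Set where
    constructor extension
    field
      {lines}  : List (DNF V)
      extended : Derivation e Γ lines
      extends  : Xs ⊆ lines
      cost     : #rules extended ≤ m + #rules π
      contains : lines ⊩ Zs

  infix 4 _⊢[_]_

  -- Stated as a way to extend any derivation that already contains `Hs`, so that a line of the dag
  -- is paid for once and then shared by all its later uses.
  record _⊢[_]_ (Hs : List (DNF V)) (m : ℕ) (Zs : List (DNF V)) : Set where
    field
      extend : ∀ {Xs} (π : Derivation e Γ Xs) → Xs ⊩ Hs → Extension π m Zs

  open _⊢[_]_
  open Extension

  variable
    Hs Ys Zs : List (DNF V)
    X Y Z : DNF V
    a b m k : ℕ

  ⊩-mono : ∀ {Xs Ys} → Xs ⊆ Ys → Xs ⊩ Zs → Ys ⊩ Zs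
  ⊩-mono sub = All.map (Any-resp-⊆ sub)

  hyps : Zs ⊆ Hs → Hs ⊢[ 0 ] Zs
  hyps sub .extend π hs = extension π ⊆-refl ≤-refl (All-resp-⊇ sub hs)

  hyp : Z ∈ Hs → Hs ⊢[ 0 ] [ Z ]
  hyp Z∈Hs = hyps λ { (here refl) → Z∈Hs }

  resp : X ≈ Z → Hs ⊢[ m ] [ X ] → Hs ⊢[ m ] [ Z ]
  resp {X = X} {Z} X≈Z t .extend π hs with extend t π hs
  ... | extension ρ sub c (x ∷ []) = extension ρ sub c (Any.map (λ W≈X → ≈-trans W≈X X≈Z) x ∷ [])

  relax : m ≤ k → Hs ⊢[ m ] Zs → Hs ⊢[ k ] Zs
  relax m≤k t .extend π hs with extend t π hs
  ... | extension ρ sub c zs = extension ρ sub (≤-trans c (+-monoˡ-≤ _ m≤k)) zs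

  private
    accumulate : ∀ {x y z} m k → y ≤ m + x → z ≤ k + y → z ≤ (m + k) + x
    accumulate {x} m k y≤ z≤ = ≤-trans z≤ (≤-trans (+-monoʳ-≤ k y≤)
      (≤-reflexive (trans (sym (+-assoc k m x)) (cong (_+ x) (+-comm k m)))))

  infixr 4 _▷_
  _▷_ : Hs ⊢[ m ] Ys → (Ys ++ Hs) ⊢[ k ] Zs → Hs ⊢[ m + k ] Zs
  _▷_ {m = m} {k = k} t u .extend π hs with extend t π hs
  ... | extension ρ sub c ys with extend u ρ (All.++⁺ ys (⊩-mono sub hs))
  ... | extension σ sub′ c′ zs = extension σ (⊆-trans sub sub′)
    (accumulate m k c c′) zs

  both : Hs ⊢[ m ] Ys → Hs ⊢[ k ] Zs → Hs ⊢[ m + k ] Ys ++ Zs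
  both {m = m} {k = k} t u .extend π hs with extend t π hs
  ... | extension ρ sub c ys with extend u ρ (⊩-mono sub hs)
  ... | extension σ sub′ c′ zs = extension σ (⊆-trans sub sub′)
    (accumulate m k c c′) (All.++⁺ (⊩-mono sub′ ys) zs)

  each : ∀ {I : Set} {Z : I → DNF V} → (∀ i → Hs ⊢[ m ] [ Z i ]) →
         ∀ is → Hs ⊢[ length is * m ] map Z is
  each t []       = hyps λ ()
  each t (i ∷ is) = both (t i) (each t is)

  eachFin : ∀ {n} {Z : Fin n → DNF V} → (∀ i → Hs ⊢[ m ] [ Z i ]) →
            Hs ⊢[ n * m ] map Z (allFin n)
  eachFin {m = m} {n} t =
    relax (≤-reflexive (cong (_* m) (length-allFin n))) (each t (allFin n))

  -- Free, because only rule applications count. The width is fine because `e` is a successor.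
  clause : ∀ {c} → Γ c → Hs ⊢[ 0 ] [ asDNF c ]
  clause {c = c} c∈Γ .extend π hs =
    extension (axiom π c c∈Γ (All.map⁺ (All.universal (λ _ → s≤s z≤n) c))) there ≤-refl
      (here ≈-refl ∷ [])

  lines-IsDNF : ∀ {Xs} → Derivation e Γ Xs → All (IsDNF e) Xs
  lines-IsDNF []             = []
  lines-IsDNF (axiom π _ _ b)  = b ∷ lines-IsDNF π
  lines-IsDNF (rule π _ b _ _) = b ∷ lines-IsDNF π

  IsDNF-resp : X ≈ Y → IsDNF e X → IsDNF e Y
  IsDNF-resp X≈Y = All-resp-⊇ (from X≈Y)

  contained-IsDNF : ∀ {Xs} → Derivation e Γ Xs → Any (_≈ X) Xs → IsDNF e X
  contained-IsDNF π x with All.lookupAny (lines-IsDNF π) x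
  ... | b , X′≈X = IsDNF-resp X′≈X b

  -- The line present in the derivation is known only up to `≈`, so the rule must accept every such
  -- variant. The width of the conclusion may be deduced from that of the premise, as all lines of a
  -- derivation are `e`-DNFs.
  step₁ : (∀ {X′} → X′ ≈ X → Rule [ X′ ] Z) → (IsDNF e X → IsDNF e Z) →
          Hs ⊢[ a ] [ X ] → Hs ⊢[ suc a ] [ Z ]
  step₁ {Z = Z} r b t .extend π hs with extend t π hs
  ... | extension ρ sub c (x ∷ []) = extension
    (rule ρ Z (b (contained-IsDNF ρ x)) (index x ∷ []) (r (lookup-index x)))
    (there ∘ sub) (s≤s c) (here ≈-refl ∷ [])

  step₂ : (∀ {X′ Y′} → X′ ≈ X → Y′ ≈ Y → Rule (X′ ∷ Y′ ∷ []) Z) →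
          (IsDNF e X → IsDNF e Y → IsDNF e Z) →
          Hs ⊢[ a ] [ X ] → Hs ⊢[ b ] [ Y ] → Hs ⊢[ suc (a + b) ] [ Z ]
  step₂ {Z = Z} r b t u .extend π hs with extend (both t u) π hs
  ... | extension ρ sub c (x ∷ y ∷ []) = extension
    (rule ρ Z (b (contained-IsDNF ρ x) (contained-IsDNF ρ y)) (index x ∷ index y ∷ [])
      (r (lookup-index x) (lookup-index y)))
    (there ∘ sub) (s≤s c) (here ≈-refl ∷ [])

  ≋-refl : X ≋ X
  ≋-refl = ≈⇒≋ ≈-refl

  conjoin : ∀ {P Q} C₁ C₂ → length (C₁ ++ C₂) ≤ e →
            Hs ⊢[ a ] [ C₁ ∷ P ] → Hs ⊢[ b ] [ C₂ ∷ Q ] →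
            Hs ⊢[ suc (a + b) ] [ (C₁ ++ C₂) ∷ P ++ Q ]
  conjoin {P = P} {Q} C₁ C₂ C≤e = step₂
    (λ X′≈X Y′≈Y → ∧-intro P Q C₁ C₂ (≈⇒≋ X′≈X) (≈⇒≋ Y′≈Y) ≋-refl)
    (λ { (_ ∷ p) (_ ∷ q) → C≤e ∷ All.++⁺ p q })

  resolve : ∀ {P Q} ls {A C} → asDNF ls ≡ A → map ∼_ ls ≡ C →
            Hs ⊢[ a ] [ A ++ P ] → Hs ⊢[ b ] [ C ∷ Q ] → Hs ⊢[ suc (a + b) ] [ P ++ Q ]
  resolve {P = P} {Q} ls refl refl = step₂
    (λ X′≈X Y′≈Y → cut P Q ls (≈⇒≋ X′≈X) (≈⇒≋ Y′≈Y) ≋-refl)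
    (λ { p (_ ∷ q) → All.++⁺ (All.++⁻ʳ (asDNF ls) p) q })

  weaken : ∀ {P} Q → IsDNF e Q → Hs ⊢[ a ] [ P ] → Hs ⊢[ length Q + a ] [ Q ++ P ]
  weaken []      []        t = t
  weaken (C ∷ Q) (C≤e ∷ b) t = step₁
    (λ X′≈X → weaken₁ _ C (≈⇒≋ X′≈X) ≋-refl) (C≤e ∷_) (weaken Q b t)

  project : ∀ {P} C₁ C₂ → Hs ⊢[ a ] [ (C₁ ++ C₂) ∷ P ] → Hs ⊢[ suc a ] [ C₁ ∷ P ]
  project C₁ C₂ = step₁
    (λ X′≈X → weaken₂ _ C₁ C₂ (≈⇒≋ X′≈X) ≋-refl)
    (λ { (C≤e ∷ p) → ≤-trans (subst (length C₁ ≤_) (sym (length-++ C₁)) (m≤m+n _ _)) C≤e ∷ p })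

  -- A loop: `F xs` are the lines available while `xs` remains to be processed, `P` is a side
  -- condition on what remains, and each round consumes one element.
  iterate : ∀ {I : Set} (F : List I → List (DNF V)) (P : List I → Set) →
            (∀ {x xs} → P (x ∷ xs) → P xs × ((F (x ∷ xs) ++ Hs) ⊢[ m ] F xs)) →
            ∀ xs → P xs → (F xs ++ Hs) ⊢[ length xs * m ] F []
  iterate F P body [] _ = hyps ∈-++⁺ˡ
  iterate {Hs = Hs} F P body (x ∷ xs) Px = let Pxs , t = body Px in
    t ▷ weakenHyps (iterate {Hs = Hs} F P body xs Pxs)
    where
    weakenHyps : ∀ {k} → (F xs ++ Hs) ⊢[ k ] F [] → (F xs ++ F (x ∷ xs) ++ Hs) ⊢[ k ] F []
    weakenHyps t .extend π hs with All.++⁻ (F xs) hs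
    ... | hs₁ , hs₂ = extend t π (All.++⁺ hs₁ (All.++⁻ʳ (F (x ∷ xs)) hs₂))

  refute : [] ⊢[ m ] [ [] ] → Σ[ ρ ∈ Refutation e Γ ] size ρ ≤ m
  refute {m} t with extend t [] []
  ... | extension π _ c (x ∷ []) =
    let ρ , size≤ = refutation π (Any.map empty x)
    in ρ , ≤-trans size≤ (subst (_ ≤_) (+-identityʳ m) c)
    where
    empty : ∀ {W} → W ≈ [] → [] ≡ W
    empty {[]}    _    = refl
    empty {_ ∷ _} W≈[] with () ← to W≈[] (here refl)

-- The rule count and its cubic bound.

rules slack : ℕ → ℕ → ℕ
rules n d = n * ((d + n) + n * suc d) + (n * (1 + n * (2 + n * 4)) + d)
-- 12 d n³ − rules n d, expanded in a = n − 1 and b = d − 1.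
slack a b = 12 * (a * a * a * b) + 35 * (a * a * b) + 33 * (a * b) + 9 * b
            + 8 * (a * a * a) + 19 * (a * a) + 12 * a

rules+slack : ∀ a b → rules (suc a) (suc b) + slack a b ≡ 12 * suc b * suc a ^ 3
rules+slack = solve 2 (λ a b → let n = con 1 :+ a; d = con 1 :+ b in
    (n :* ((d :+ n) :+ n :* (con 1 :+ d)) :+ (n :* (con 1 :+ n :* (con 2 :+ n :* con 4)) :+ d))
    :+ (con 12 :* (a :* a :* a :* b) :+ con 35 :* (a :* a :* b) :+ con 33 :* (a :* b)
        :+ con 9 :* b :+ con 8 :* (a :* a :* a) :+ con 19 :* (a :* a) :+ con 12 :* a)
    := con 12 :* d :* (n :^ 3)) refl
  where open +-*-Solver

rules-bound : ∀ a b → rules (suc a) (suc b) ≤ 12 * suc b * suc a ^ 3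
rules-bound a b = subst (rules (suc a) (suc b) ≤_) (rules+slack a b)
  (m≤m+n (rules (suc a) (suc b)) (slack a b))

-- The formulas of the refutation and the initial lines.

module _ {d n : ℕ} where

  open Calculus d (RLNP d n)
  open ICMSolver (++-idempotentCommutativeMonoid (Conjunction (Var d n))) using (solve; _⊕_; _⊜_)

  -- Partial versions of ℛ_i, needed because `successor-below` collects its literals one at a time.
  ℛs : List (Fin d) → Fin n → Conjunction (Var d n)
  ℛs ps i = map (λ p → pos (R p i)) ps

  ℛ : Fin n → Conjunction (Var d n)
  ℛ = ℛs (allFin d)

  N : Fin n → DNF (Var d n)
  N i = asDNF (¬ℛ i)

  below : Fin n → Fin n → Conjunction (Var d n)
  below i j = ℛ i ++ [ pos (L i j) ]

  B : List (Fin n) → Fin n → DNF (Var d n)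
  B is j = map (λ i → below i j) is

  D : List (Fin n) → Fin n → DNF (Var d n)
  D is j = N j ++ B is j

  S⋁ : List (Fin n) → Fin n → DNF (Var d n)
  S⋁ is j = asDNF (map (λ i → pos (S i j)) is)

  length-below : ∀ ps i j → length (ℛs ps i ++ [ pos (L i j) ]) ≡ suc (length ps)
  length-below ps i j = trans (length-++ (ℛs ps i))
    (trans (+-comm _ 1) (cong suc (length-map _ ps)))

  below-bound : ∀ i j → length (below i j) ≤ suc d
  below-bound i j = ≤-reflexive (trans (length-below (allFin d) i j) (cong suc (length-allFin d)))

  ∼¬ℛ : ∀ i → map ∼_ (¬ℛ {d} {n} i) ≡ ℛ i
  ∼¬ℛ i = sym (map-∘ (allFin d))

  -- The negation of `below i j` is the clause ¬ℛ_i ∨ ¬L_{i,j}, which is contained in both the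
  -- irreflexivity and the transitivity axioms; one cut therefore removes the whole conjunction.
  resolve-below : ∀ {Hs a b P Q} i j →
                  Hs ⊢[ a ] [ (N i ++ [ [ neg (L i j) ] ]) ++ P ] →
                  Hs ⊢[ b ] [ below i j ∷ Q ] → Hs ⊢[ suc (a + b) ] [ P ++ Q ]
  resolve-below i j = resolve (¬ℛ i ++ [ neg (L i j) ]) (map-++ [_] (¬ℛ i) _)
    (trans (map-++ ∼_ (¬ℛ i) _) (cong (_++ _) (∼¬ℛ i)))

  clause-irreflexive : ∀ {Hs} i → Hs ⊢[ 0 ] [ N i ++ [ [ neg (L i i) ] ] ]
  clause-irreflexive i = resp (≈-reflexive (map-++ [_] (¬ℛ i) _)) (clause (irreflexive i))

  clause-transitive : ∀ {Hs} i j l → Hs ⊢[ 0 ]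
    [ N i ++ N j ++ N l ++ [ [ neg (L i j) ] ] ++ [ [ neg (L j l) ] ] ++ [ [ pos (L i l) ] ] ]
  clause-transitive i j l = resp
    (≈-reflexive (trans (map-++ [_] (¬ℛ i) _) (cong (N i ++_)
      (trans (map-++ [_] (¬ℛ j) _) (cong (N j ++_) (map-++ [_] (¬ℛ l) _))))))
    (clause (transitive i j l))

  head-last : ∀ i j l → asDNF (neg (S i j) ∷ ¬ℛ j ++ [ l ]) ≈ [ l ] ∷ [ [ neg (S i j) ] ] ++ N j
  head-last i j l = ≈-trans
    (≈-reflexive (cong ([ neg (S i j) ] ∷_) (map-++ [_] (¬ℛ j) [ l ])))
    (solve 3 (λ s nj l → s ⊕ (nj ⊕ l) ⊜ l ⊕ (s ⊕ nj)) ≈-refl [ [ neg (S i j) ] ] (N j) [ [ l ] ])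

  -- Start from `S⇒L` and join in each R^p_i from `S⇒R` by one ∧-introduction. The side formulas
  -- agree, so idempotence merges them.
  successor-below : ∀ {Hs} i j ps → length ps ≤ d →
    Hs ⊢[ length ps ] [ (ℛs ps i ++ [ pos (L i j) ]) ∷ [ [ neg (S i j) ] ] ++ N j ]
  successor-below i j [] _ = resp (head-last i j (pos (L i j))) (clause (S⇒L i j))
  successor-below i j (p ∷ ps) b = resp
    (solve 2 (λ c m → c ⊕ (m ⊕ m) ⊜ c ⊕ m) ≈-refl
      [ ℛs (p ∷ ps) i ++ [ pos (L i j) ] ] ([ [ neg (S i j) ] ] ++ N j))
    (conjoin [ pos (R p i) ] _ (≤-trans (≤-reflexive (length-below (p ∷ ps) i j)) (s≤s b))
      (resp (head-last i j (pos (R p i))) (clause (S⇒R i j p)))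
      (successor-below i j ps (≤-trans (n≤1+n _) b)))

  initial : ∀ {Hs} j → Hs ⊢[ (d + n) + n * suc d ] [ D (allFin n) j ]
  initial {Hs} j = relax (≤-reflexive cost)
    -- The successor clause is first weakened by all of `D all j`, at `d + n` rules; afterwards
    -- every disjunct that a cut on some S_{i,j} brings in is already there. Each such cut costs `d`
    -- ∧-introductions and itself.
    (resp (solve 2 (λ a b → a ⊕ b ⊜ b ⊕ a) ≈-refl (D all j) (S⋁ all j))
       (weaken (D all j) D-bound (clause successor-S⋁)) ▷
     iterate (λ is → [ S⋁ is j ++ D all j ]) (λ _ → ⊤) (λ {i} {is} _ → _ , use i is) all _)
    where
    all = allFin n
    successor-S⋁ : RLNP d n (map (λ i → pos (S i j)) all)
    successor-S⋁ = successor j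
    D-bound : IsDNF (suc d) (D all j)
    D-bound = All.++⁺ (All.map⁺ (All.universal (λ _ → s≤s z≤n) (¬ℛ j)))
                      (All.map⁺ (All.universal (λ i → below-bound i j) all))
    cost : length (D all j) + 0 + length all * suc d ≡ (d + n) + n * suc d
    cost = cong₂ _+_ (trans (+-identityʳ _) (trans (length-++ (N j)) (cong₂ _+_
      (trans (length-map [_] (¬ℛ {d} j))
        (trans (length-map (λ p → neg (R p j)) (allFin d)) (length-allFin d)))
      (trans (length-map _ all) (length-allFin n))))) (cong (_* suc d) (length-allFin n))
    use : ∀ i is → ([ S⋁ (i ∷ is) j ++ D all j ] ++ Hs) ⊢[ suc d ] [ S⋁ is j ++ D all j ]
    use i is = resp (absorb (⊆-trans sub (xs⊆ys++xs _ (S⋁ is j))))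
      (relax (≤-reflexive (cong suc (trans (+-identityʳ _) (length-allFin d))))
        (resolve {P = N j ++ [ below i j ]} [ neg (S i j) ] refl refl
          (resp
            (solve 3 (λ c s nj → c ⊕ (s ⊕ nj) ⊜ s ⊕ (nj ⊕ c)) ≈-refl
              [ below i j ] [ [ neg (S i j) ] ] (N j))
            (successor-below i j (allFin d) (≤-reflexive (length-allFin d))))
          (hyp (here refl))))
      where
      sub : N j ++ [ below i j ] ⊆ D all j
      sub = ++⁺ (⊆-refl {x = N j}) λ { (here refl) → ∈-map⁺ _ (∈-allFin i) }

  -- Removing an element from all the lines.

  isolate : ∀ i j is → D (i ∷ is) j ≈ below i j ∷ D is j
  isolate i j is = solve 3 (λ nj c b → nj ⊕ (c ⊕ b) ⊜ c ⊕ (nj ⊕ b)) ≈-refl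
    (N j) [ below i j ] (B is j)

  eliminate : ∀ {Hs} k j is → D (k ∷ is) j ∈ Hs → (N k ++ B is k) ∈ Hs →
              Hs ⊢[ 2 + length is * 4 ] [ D is j ]
  eliminate {Hs} k j is D∈ G∈ =
    resolve {P = B is k} {Q = D is j} (¬ℛ k) refl (∼¬ℛ k) (hyp G∈)
      (project (ℛ k) [ pos (L k j) ] (resp (isolate k j is) (hyp D∈))) ▷
    -- Only `xs` shrinks while `D is j` stays fixed; membership in `is` is carried along so that
    -- each new `below i j` is already a disjunct of `D is j`.
    iterate (λ xs → [ B xs k ++ D is j ]) (All (_∈ is))
      (λ { {i} {xs} (i∈is ∷ xs⊆is) → xs⊆is , replace i xs i∈is }) is (All.tabulate id)
    where
    module _ (i : Fin n) where
      ¬Lik ¬Lkj Lij : DNF (Var d n)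
      ¬Lik = [ [ neg (L i k) ] ]
      ¬Lkj = [ [ neg (L k j) ] ]
      Lij  = [ [ pos (L i j) ] ]

      -- Transitivity through `k`, with ℛ_k ∧ L_{k,j} supplied by the original line rather than
      -- assumed: what is left says that a relevant `i` below `k` is below `j`, unless `D is j`
      -- holds anyway.
      chain : ∀ {Hs} → D (k ∷ is) j ∈ Hs → Hs ⊢[ 1 ] [ (N i ++ ¬Lik) ++ Lij ++ D is j ]
      chain D∈ = resp
        (solve 5 (λ ni nj ¬ik ij b → (ni ⊕ ¬ik ⊕ nj ⊕ ij) ⊕ nj ⊕ b ⊜ (ni ⊕ ¬ik) ⊕ ij ⊕ nj ⊕ b)
          ≈-refl
          (N i) (N j) ¬Lik Lij (B is j))
        (resolve-below {P = N i ++ ¬Lik ++ N j ++ Lij} {Q = D is j} k j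
          (resp
            (solve 6 (λ ni nk nj ¬ik ¬kj ij →
               ni ⊕ nk ⊕ nj ⊕ ¬ik ⊕ ¬kj ⊕ ij ⊜ (nk ⊕ ¬kj) ⊕ ni ⊕ ¬ik ⊕ nj ⊕ ij) ≈-refl
              (N i) (N k) (N j) ¬Lik ¬Lkj Lij)
            (clause-transitive i k j))
          (resp (isolate k j is) (hyp D∈)))

      -- The four rules are a projection to ℛ_i, the cut in `chain`, a cut on `below i k` yielding
      -- L_{i,j}, and the ∧-introduction of `below i j`.
      replace : ∀ xs → i ∈ is → ([ B (i ∷ xs) k ++ D is j ] ++ Hs) ⊢[ 4 ] [ B xs k ++ D is j ]
      replace xs i∈is = resp
        (≈-trans
          (solve 3 (λ c b t → c ⊕ (b ⊕ t) ⊕ t ⊕ b ⊕ t ⊜ c ⊕ b ⊕ t) ≈-refl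
            [ below i j ] (B xs k) (D is j))
          (absorb {xs = [ below i j ]}
            λ { (here refl) → ∈-++⁺ʳ (B xs k) (∈-++⁺ʳ (N j) (∈-map⁺ _ i∈is)) }))
        (conjoin (ℛ i) [ pos (L i j) ] (below-bound i j)
          (project (ℛ i) [ pos (L i k) ] (hyp (here refl)))
          (resolve-below {P = Lij ++ D is j} {Q = B xs k ++ D is j} i k
            (chain (there D∈)) (hyp (here refl))))

  eliminate-all : ∀ {Hs} k is → length is ≤ n →
    (map (D (k ∷ is)) (allFin n) ++ Hs) ⊢[ 1 + n * (2 + n * 4) ] map (D is) (allFin n)
  eliminate-all {Hs} k is b =
    -- This line is derived once per `k` and shared by all `j`, hence the single `1` outside the
    -- factor `n`.
    resolve-below {P = []} {Q = N k ++ B is k} k k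
      (resp (≈-reflexive (sym (++-identityʳ _))) (clause-irreflexive k))
      (resp (isolate k k is) (hyp (∈-++⁺ˡ (∈-map⁺ _ (∈-allFin k))))) ▷
    eachFin (λ j → relax (+-monoʳ-≤ 2 (*-monoˡ-≤ 4 b))
      (eliminate k j is (there (∈-++⁺ˡ (∈-map⁺ _ (∈-allFin j)))) (here refl)))

  final : ∀ {Hs} i → suc (toℕ i) ≡ n → (N i ∷ Hs) ⊢[ d ] [ [] ]
  final {Hs} i i≡n = relax (≤-reflexive (trans (*-identityʳ _) (length-allFin d)))
    (iterate (λ ps → [ asDNF (map (λ p → neg (R p i)) ps) ]) (λ _ → ⊤)
      (λ {p} {ps} _ → _ , discharge p ps) (allFin d) _)
    where
    discharge : ∀ p ps → (asDNF (map (λ q → neg (R q i)) (p ∷ ps)) ∷ Hs)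
                         ⊢[ 1 ] [ asDNF (map (λ q → neg (R q i)) ps) ]
    discharge p ps = resolve {P = []} [ pos (R p i) ] refl refl (clause (last i p i≡n)) (hyp (here refl))

  -- The summands of `rules n d` are, in order, the `n` initial lines, the `n` rounds of removal,
  -- and the `d` cuts with the unit clauses R^p_n.
  refutes : ∀ i → suc (toℕ i) ≡ n → [] ⊢[ rules n d ] [ [] ]
  refutes i i≡n =
    eachFin initial ▷
    relax (≤-reflexive (cong (_* (1 + n * (2 + n * 4))) (length-allFin n)))
      (iterate (λ is → map (D is) (allFin n)) (λ is → length is ≤ n)
        (λ {k} {is} b → ≤-trans (n≤1+n _) b , eliminate-all k is (≤-trans (n≤1+n _) b))
        (allFin n) (≤-reflexive (length-allFin n))) ▷
    resp (≈-reflexive (++-identityʳ (N i))) (hyp (∈-++⁺ˡ (∈-map⁺ (D []) (∈-allFin i)))) ▷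
    final i i≡n

proposition1 : ∃[ C ] (∀ (n d : ℕ) → 1 ≤ n → 1 ≤ d →
    Σ[ π ∈ Refutation (suc d) (RLNP d n) ] size π ≤ C * d * n ^ 3)
-- 12 is the value of `rules 1 1`, where the slack vanishes.
proposition1 = 12 , λ where
  (suc a) (suc b) _ _ →
    Calculus.refute (suc b) (RLNP (suc b) (suc a))
      (Calculus.relax _ _ (rules-bound a b) (refutes (fromℕ a) (cong suc (Fin.toℕ-fromℕ a))))
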